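{- Let $X \in \{\mathrm{LD},\mathrm{LTD},\mathrm{OD},\mathrm{OTD},\mathrm{ID},\mathrm{ITD},\mathrm{FD},\mathrm{FTD}\}$ and let $G$ be an X-admissible graph on $n$ vertices. Then $$\gamma^{X}(G) \ge \begin{cases} \lfloor \log_2 n \rfloor & \text{if } X \in \{\mathrm{LD},\mathrm{LTD}\},\\ \lceil \log_2 n\rceil & \text{if } X=\mathrm{OD},\\ \lceil \log_2(n+1)\rceil & \text{if } X\in\{\mathrm{OTD},\mathrm{ID},\mathrm{ITD}\},\\ 1+\lfloor\log_2 n\rfloor & \text{if } X=\mathrm{FD},\\ 1+\lfloor \log_2(n+1)\rfloor & \text{if } X=\mathrm{FTD}.\end{cases}$$
   Context: Graphs are finite, simple and undirected. For a graph $G=(V,E)$ and $v\in V$, $N(v)$ is the open neighborhood and $N[v]=N(v)\cup\{v\}$ the closed neighborhood. A set $C\subseteq V$ is dominating (resp. total-dominating) if $N[v]\cap C\neq\emptyset$ (resp. $N(v)\cap C\ne\emptyset$) for all $v\in V$. It is location-separating (L-separating) if $N(u)\cap C\neq N(v)\cap C$ for all distinct $u,v\in V\setminus C$; open-separating (O-separating) if $N(u)\cap C\neq N(v)\cap C$ for all distinct $u,v\in V$; closed-separating (I-separating) if $N[u]\cap C\neq N[v]\cap C$ for all distinct $u,v\in V$; full-separating (F-separating) if it is both open- and closed-separating. For $S\in\{L,O,I,F\}$, an $S$D-code (resp. $S$TD-code) is an $S$-separating set that is dominating (resp. total-dominating); this defines LD-, LTD-, OD-, OTD-, ID-, ITD-,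 FD- and FTD-codes. A graph is X-admissible if it has an X-code; $\gamma^{X}(G)$ is the minimum cardinality of an X-code of $G$. -}

module Defs where

open import Data.Bool.Properties using () renaming (_≟_ to _≟ᵇ_)
open import Data.Fin using (Fin)
open import Data.Fin.Properties using (all?; _≟_)
open import Data.Fin.Subset using (Subset; _∉_; _∩_; _∪_; ⁅_⁆; ∣_∣; Nonempty)
open import Data.Fin.Subset.Properties using (_∈?_; nonempty?; anySubset?)
open import Data.Nat using (ℕ; _+_; _≤_; _<_; _<?_)
open import Data.Nat.Induction using (<-wellFounded)
open import Data.Nat.Logarithm using (⌊log₂_⌋; ⌈log₂_⌉)
open import Data.Nat.Properties using (≮⇒≥)
open import Data.Product using (∃; _×_; _,_; proj₁)
open import Data.Vec using (tabulate)
open import Data.Vec.Properties using (≡-dec)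
open import Induction.WellFounded using (Acc; acc)
open import Level using (0ℓ)
open import Relation.Binary using (Rel; Symmetric; Irreflexive; Decidable)
open import Relation.Binary.PropositionalEquality using (_≡_; _≢_)
open import Relation.Nullary using (Dec; yes; no; does; ¬?; _×-dec_; _→-dec_)

-- Simple undirected graphs with vertex set Fin n.
record Graph (n : ℕ) : Set₁ where
  field
    Adj         : Rel (Fin n) 0ℓ
    adj?        : Decidable Adj
    symmetric   : Symmetric Adj
    irreflexive : Irreflexive _≡_ Adj

  N : Fin n → Subset n
  N v = tabulate λ u → does (adj? v u)

  N[_] : Fin n → Subset n
  N[ v ] = N v ∪ ⁅ v ⁆

  Dominating : Subset n → Set
  Dominating C = ∀ v → Nonempty (N[ v ] ∩ C)

  TotalDominating : Subset n → Set
  TotalDominating C = ∀ v → Nonempty (N v ∩ C)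

  -- Subsets are Boolean vectors, so _≡_ on them is extensional equality of sets.
  LSeparating : Subset n → Set
  LSeparating C = ∀ u v → u ∉ C → v ∉ C → u ≢ v → N u ∩ C ≢ N v ∩ C

  OSeparating : Subset n → Set
  OSeparating C = ∀ u v → u ≢ v → N u ∩ C ≢ N v ∩ C

  ISeparating : Subset n → Set
  ISeparating C = ∀ u v → u ≢ v → N[ u ] ∩ C ≢ N[ v ] ∩ C

  FSeparating : Subset n → Set
  FSeparating C = OSeparating C × ISeparating C

data CodeType : Set where
  LD LTD OD OTD ID ITD FD FTD : CodeType

module _ {n : ℕ} (G : Graph n) where
  open Graph G

  IsCode : CodeType → Subset n → Set
  IsCode LD  C = LSeparating C × Dominating C
  IsCode LTD C = LSeparating C × TotalDominating C
  IsCode OD  C = OSeparating C × Dominating C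
  IsCode OTD C = OSeparating C × TotalDominating C
  IsCode ID  C = ISeparating C × Dominating C
  IsCode ITD C = ISeparating C × TotalDominating C
  IsCode FD  C = FSeparating C × Dominating C
  IsCode FTD C = FSeparating C × TotalDominating C

  Admissible : CodeType → Set
  Admissible X = ∃ λ C → IsCode X C

  IsMinimumCode : CodeType → Subset n → Set
  IsMinimumCode X C = IsCode X C × (∀ D → IsCode X D → ∣ C ∣ ≤ ∣ D ∣)

  private
    _≟ˢ_ : (p q : Subset n) → Dec (p ≡ q)
    _≟ˢ_ = ≡-dec _≟ᵇ_

    dominating? : ∀ C → Dec (Dominating C)
    dominating? C = all? λ v → nonempty? (N[ v ] ∩ C)

    totalDominating? : ∀ C → Dec (TotalDominating C)
    totalDominating? C = all? λ v → nonempty? (N v ∩ C)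

    lSeparating? : ∀ C → Dec (LSeparating C)
    lSeparating? C = all? λ u → all? λ v →
      ¬? (u ∈? C) →-dec (¬? (v ∈? C) →-dec
        (¬? (u ≟ v) →-dec ¬? ((N u ∩ C) ≟ˢ (N v ∩ C))))

    oSeparating? : ∀ C → Dec (OSeparating C)
    oSeparating? C = all? λ u → all? λ v →
      ¬? (u ≟ v) →-dec ¬? ((N u ∩ C) ≟ˢ (N v ∩ C))

    iSeparating? : ∀ C → Dec (ISeparating C)
    iSeparating? C = all? λ u → all? λ v →
      ¬? (u ≟ v) →-dec ¬? ((N[ u ] ∩ C) ≟ˢ (N[ v ] ∩ C))

    fSeparating? : ∀ C → Dec (FSeparating C)
    fSeparating? C = oSeparating? C ×-dec iSeparating? C

  isCode? : ∀ X C → Dec (IsCode X C)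
  isCode? LD  C = lSeparating? C ×-dec dominating? C
  isCode? LTD C = lSeparating? C ×-dec totalDominating? C
  isCode? OD  C = oSeparating? C ×-dec dominating? C
  isCode? OTD C = oSeparating? C ×-dec totalDominating? C
  isCode? ID  C = iSeparating? C ×-dec dominating? C
  isCode? ITD C = iSeparating? C ×-dec totalDominating? C
  isCode? FD  C = fSeparating? C ×-dec dominating? C
  isCode? FTD C = fSeparating? C ×-dec totalDominating? C

  minimumCode : ∀ X → Admissible X → ∃ λ C → IsMinimumCode X C
  minimumCode X (C₀ , code₀) = descend C₀ code₀ (<-wellFounded ∣ C₀ ∣)
    where
    descend : ∀ C → IsCode X C → Acc _<_ ∣ C ∣ → ∃ λ C′ → IsMinimumCode X C′
    descend C code (acc smaller)
      with anySubset? (λ D → isCode? X D ×-dec (∣ D ∣ <? ∣ C ∣))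
    ... | yes (D , codeD , D<C) = descend D codeD (smaller D<C)
    ... | no  ∄D = C , code , λ D codeD → ≮⇒≥ λ D<C → ∄D (D , codeD , D<C)

  γ : ∀ X → Admissible X → ℕ
  γ X adm = ∣ proj₁ (minimumCode X adm) ∣

lowerBound : CodeType → ℕ → ℕ
lowerBound LD  n = ⌊log₂ n ⌋
lowerBound LTD n = ⌊log₂ n ⌋
lowerBound OD  n = ⌈log₂ n ⌉
lowerBound OTD n = ⌈log₂ (n + 1) ⌉
lowerBound ID  n = ⌈log₂ (n + 1) ⌉
lowerBound ITD n = ⌈log₂ (n + 1) ⌉
lowerBound FD  n = 1 + ⌊log₂ n ⌋
lowerBound FTD n = 1 + ⌊log₂ (n + 1) ⌋

{-# OPTIONS --safe #-}

-- A separating set C of size k makes the traces N(v) ∩ C (or N[v] ∩ C) distinct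
-- among the 2^k subsets of C, and domination excludes the empty trace.  For LD
-- and LTD only vertices outside C are separated; one more bit, marking membership
-- in C, separates all of them.  For FTD one further subset is never an open trace:
-- N[v] ∩ C, where v ∈ C has a maximal open trace.
module Submission where

open import Defs
open import Data.Bool using (_∧_)
open import Data.Bool.Properties using (∧-zeroʳ) renaming (_≟_ to _≟ᵇ_)
open import Data.Fin using (Fin; zero; suc; combine)
open import Data.Fin.Properties using (any?; combine-injective; injective⇒≤; _≟_)
open import Data.Fin.Subset using (Subset; inside; outside; ⊥; _∈_; _∉_; _⊂_; _⊃_;
  _∩_; _∪_; ⁅_⁆; ∣_∣; Nonempty; Empty; Side)
open import Data.Fin.Subset.Induction using (⊃-wellFounded)
open import Data.Fin.Subset.Properties
  using (_∈?_; x∈p∩q⁺; x∈p∩q⁻; p⊆p∪q; q⊆p∪q; x∈⁅x⁆; x∈⁅y⁆⇒x≡y; ∉⊥; Empty-unique; ∩-zeroˡ; ∩-distribʳ-∪; ∪-identityʳ)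
open import Data.Nat using (ℕ; zero; suc; _+_; _*_; _∸_; _^_; _≤_; _<_; _≥_;
  s≤s; s≤s⁻¹; ⌊_/2⌋; ⌈_/2⌉; NonZero; ≢-nonZero⁻¹)
open import Data.Nat.Logarithm
  using (⌊log₂_⌋; ⌈log₂_⌉; ⌊log₂⌋-mono-≤; ⌊log₂⌊n/2⌋⌋≡⌊log₂n⌋∸1; ⌈log₂⌉-mono-≤; ⌈log₂2^n⌉≡n)
open import Data.Nat.Properties
  using (≤-trans; ≤-reflexive; +-comm; +-identityʳ; m≤n+m∸n; n<1⇒n≡0; ⌊n/2⌋-mono; n≡⌈n+n/2⌉; module ≤-Reasoning)
open import Data.Product using (∃; _,_; proj₁; proj₂; map₂)
open import Data.Vec using ([]; _∷_)
open import Data.Vec.Functional using () renaming (_∷_ to _◂_)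
open import Data.Vec.Properties using (≡-dec; ∷-injectiveʳ; []=⇒lookup; lookup∘tabulate)
open import Function using (Injective; _∘_)
open import Induction.WellFounded using (Acc; acc)
open import Relation.Binary.PropositionalEquality
  using (_≡_; _≢_; refl; sym; trans; cong; cong₂; subst; module ≡-Reasoning)
open import Relation.Nullary using (yes; no; contradiction; decidable-stable)
open import Relation.Nullary.Decidable using (dec-false)

-- Halving `n` lowers the logarithm by one and removes one factor 2 from the bound. At `k = 0` the
-- claim would fail for `n = 0`, because `⌊log₂ 0 ⌋` is `0`.
n<2^k⇒⌊log₂n⌋<k : ∀ n k .{{_ : NonZero n}} → n < 2 ^ k → ⌊log₂ n ⌋ < k
n<2^k⇒⌊log₂n⌋<k n zero    n<1   = contradiction (n<1⇒n≡0 n<1) (≢-nonZero⁻¹ n)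
n<2^k⇒⌊log₂n⌋<k n (suc k) n<2^k = s≤s (go n k n<2^k)
  where
  go : ∀ n k → n < 2 ^ suc k → ⌊log₂ n ⌋ ≤ k
  go n zero (s≤s n≤1) = ⌊log₂⌋-mono-≤ n≤1
  go n (suc k) n<2^2+k = begin
    ⌊log₂ n ⌋              ≤⟨ m≤n+m∸n ⌊log₂ n ⌋ 1 ⟩
    1 + (⌊log₂ n ⌋ ∸ 1)    ≡⟨ cong suc (⌊log₂⌊n/2⌋⌋≡⌊log₂n⌋∸1 n) ⟨
    1 + ⌊log₂ ⌊ n /2⌋ ⌋    ≤⟨ s≤s (go ⌊ n /2⌋ k half) ⟩
    suc k                  ∎
    where
    open ≤-Reasoning
    b = 2 ^ suc k
    half : ⌊ n /2⌋ < b
    half = begin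
      -- Here `⌊ 2 + n /2⌋` computes to `suc ⌊ n /2⌋`, and `⌈ 2 * b /2⌉` is by definition
      -- `⌊ 1 + 2 * b /2⌋`.
      suc ⌊ n /2⌋    ≤⟨ ⌊n/2⌋-mono (s≤s n<2^2+k) ⟩
      ⌈ 2 * b /2⌉    ≡⟨ cong (λ x → ⌈ b + x /2⌉) (+-identityʳ b) ⟩
      ⌈ b + b /2⌉    ≡⟨ n≡⌈n+n/2⌉ b ⟨
      b              ∎

n≤2^k⇒⌈log₂n⌉≤k : ∀ {n} k → n ≤ 2 ^ k → ⌈log₂ n ⌉ ≤ k
n≤2^k⇒⌈log₂n⌉≤k k n≤2^k = ≤-trans (⌈log₂⌉-mono-≤ n≤2^k) (≤-reflexive (⌈log₂2^n⌉≡n k))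

bit : Side → Fin 2
bit outside = zero
bit inside  = suc zero

bit-injective : Injective _≡_ _≡_ bit
bit-injective {outside} {outside} _ = refl
bit-injective {inside}  {inside}  _ = refl

-- Traces on `C` as numbers with `∣ C ∣` binary digits: a target of the exact size required by the
-- pigeonhole bound `injective⇒≤`.
encode : ∀ {n} (C : Subset n) → Subset n → Fin (2 ^ ∣ C ∣)
encode []            []      = zero
encode (inside  ∷ C) (s ∷ p) = combine (bit s) (encode C p)
encode (outside ∷ C) (_ ∷ p) = encode C p

encode-injective : ∀ {n} (C p q : Subset n) → encode C p ≡ encode C q → p ∩ C ≡ q ∩ C
encode-injective []            []      []      _  = refl
encode-injective (outside ∷ C) (s ∷ p) (t ∷ q) eq =
  cong₂ _∷_ (trans (∧-zeroʳ s) (sym (∧-zeroʳ t))) (encode-injective C p q eq)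
encode-injective (inside ∷ C) (s ∷ p) (t ∷ q) eq
  with combine-injective (bit s) (encode C p) (bit t) (encode C q) eq
... | s≡t , p≡q = cong₂ (λ x r → (x ∧ inside) ∷ r) (bit-injective s≡t) (encode-injective C p q p≡q)

TraceInjective : ∀ {m n} → Subset n → (Fin m → Subset n) → Set
TraceInjective C f = Injective _≡_ _≡_ (λ i → f i ∩ C)

module _ {m n : ℕ} {C : Subset n} {f : Fin m → Subset n} where

  traceInjective⇒≤ : TraceInjective C f → m ≤ 2 ^ ∣ C ∣
  traceInjective⇒≤ inj = injective⇒≤ (inj ∘ encode-injective C _ _)

  -- Each fresh trace prepended to the `n` neighbourhoods sharpens the counting bound by one; this
  -- is why `m` is kept apart from `n`.
  ◂-traceInjective : ∀ {p} → TraceInjective C f → (∀ i → f i ∩ C ≢ p ∩ C) → TraceInjective C (p ◂ f)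
  ◂-traceInjective inj new {zero}  {zero}  _  = refl
  ◂-traceInjective inj new {zero}  {suc j} eq = contradiction (sym eq) (new j)
  ◂-traceInjective inj new {suc i} {zero}  eq = contradiction eq (new i)
  ◂-traceInjective inj new {suc i} {suc j} eq = cong suc (inj eq)

  separating⇒traceInjective : (∀ i j → i ≢ j → f i ∩ C ≢ f j ∩ C) → TraceInjective C f
  separating⇒traceInjective sep {i} {j} eq = decidable-stable (i ≟ j) (λ i≢j → sep i j i≢j eq)

nonempty⇒≢⊥∩ : ∀ {n} {p q : Subset n} → Nonempty (p ∩ q) → p ∩ q ≢ ⊥ ∩ q
nonempty⇒≢⊥∩ {q = q} (x , x∈p∩q) eq = ∉⊥ (subst (x ∈_) (trans eq (∩-zeroˡ q)) x∈p∩q)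

module _ {n : ℕ} (G : Graph n) (C : Subset n) where
  open Graph G

  v∉Nv : ∀ v → v ∉ N v
  v∉Nv v v∈N with trans (sym ([]=⇒lookup v∈N)) (trans (lookup∘tabulate _ v) (dec-false (adj? v v) (irreflexive refl)))
  ... | ()

  totalDominating⇒dominating : TotalDominating C → Dominating C
  totalDominating⇒dominating dom v with dom v
  ... | x , x∈ with x∈p∩q⁻ (N v) C x∈
  ... | x∈N , x∈C = x , x∈p∩q⁺ (p⊆p∪q ⁅ v ⁆ x∈N , x∈C)

  N[v]∩C≡Nv∩C : ∀ {v} → v ∉ C → N[ v ] ∩ C ≡ N v ∩ C
  N[v]∩C≡Nv∩C {v} v∉C = begin
    (N v ∪ ⁅ v ⁆) ∩ C         ≡⟨ ∩-distribʳ-∪ C (N v) ⁅ v ⁆ ⟩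
    (N v ∩ C) ∪ (⁅ v ⁆ ∩ C)   ≡⟨ cong ((N v ∩ C) ∪_) (Empty-unique empty) ⟩
    (N v ∩ C) ∪ ⊥             ≡⟨ ∪-identityʳ (N v ∩ C) ⟩
    N v ∩ C                   ∎
    where
    open ≡-Reasoning
    empty : Empty (⁅ v ⁆ ∩ C)
    empty (x , x∈) with x∈p∩q⁻ ⁅ v ⁆ C x∈
    ... | x∈v , x∈C = v∉C (subst (_∈ C) (x∈⁅y⁆⇒x≡y v x∈v) x∈C)

  Nv∩C⊂N[v]∩C : ∀ {v} → v ∈ C → N v ∩ C ⊂ N[ v ] ∩ C
  Nv∩C⊂N[v]∩C {v} v∈C =
    (λ x∈ → let x∈N , x∈C = x∈p∩q⁻ (N v) C x∈ in x∈p∩q⁺ (p⊆p∪q ⁅ v ⁆ x∈N , x∈C)) ,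
    v , x∈p∩q⁺ (q⊆p∪q (N v) ⁅ v ⁆ (x∈⁅x⁆ v) , v∈C) , v∉Nv v ∘ proj₁ ∘ x∈p∩q⁻ (N v) C

  oSeparating⇒≤ : OSeparating C → n ≤ 2 ^ ∣ C ∣
  oSeparating⇒≤ sep = traceInjective⇒≤ (separating⇒traceInjective sep)

  oSeparating∧totalDominating⇒< : OSeparating C → TotalDominating C → n < 2 ^ ∣ C ∣
  oSeparating∧totalDominating⇒< sep dom = traceInjective⇒≤
    -- The prepended subset is solved to `⊥`, and `_<_` unfolds to `suc n ≤ 2 ^ ∣ C ∣`.
    (◂-traceInjective (separating⇒traceInjective sep) (nonempty⇒≢⊥∩ ∘ dom))

  iSeparating∧dominating⇒< : ISeparating C → Dominating C → n < 2 ^ ∣ C ∣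
  iSeparating∧dominating⇒< sep dom = traceInjective⇒≤
    (◂-traceInjective (separating⇒traceInjective sep) (nonempty⇒≢⊥∩ ∘ dom))

  -- The leading bit of `mark v` records membership in `C`. Members are told apart by singletons,
  -- the other vertices by L-separation. The extra subset `inside ∷ ⊥` claims membership but has no
  -- element in `C`, so no vertex produces it; the resulting strictness is what lets the floor
  -- absorb the added bit.
  lSeparating⇒< : LSeparating C → n < 2 ^ suc ∣ C ∣
  lSeparating⇒< sep = traceInjective⇒≤ (◂-traceInjective {p = inside ∷ ⊥} (λ {u} {v} → inj u v) new)
    where
    mark : Fin n → Subset (suc n)
    mark v with v ∈? C
    ... | yes _ = inside  ∷ ⁅ v ⁆
    ... | no  _ = outside ∷ N v

    inj : ∀ u v → mark u ∩ (inside ∷ C) ≡ mark v ∩ (inside ∷ C) → u ≡ v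
    inj u v eq with u ∈? C | v ∈? C
    ... | yes u∈C | yes _   = x∈⁅y⁆⇒x≡y v (proj₁ (x∈p∩q⁻ ⁅ v ⁆ C
      (subst (u ∈_) (∷-injectiveʳ eq) (x∈p∩q⁺ (x∈⁅x⁆ u , u∈C)))))
    ... | no u∉C  | no v∉C  = decidable-stable (u ≟ v) λ u≢v → sep u v u∉C v∉C u≢v (∷-injectiveʳ eq)
    inj u v () | yes _ | no _
    inj u v () | no _ | yes _

    new : ∀ v → mark v ∩ (inside ∷ C) ≢ (inside ∷ ⊥) ∩ (inside ∷ C)
    new v eq with v ∈? C
    ... | yes v∈C = nonempty⇒≢⊥∩ (v , x∈p∩q⁺ (x∈⁅x⁆ v , v∈C)) (∷-injectiveʳ eq)
    new v () | no _

  -- If N(w) ∩ C = N[v] ∩ C with v ∈ C, then I-separation puts w in C, with a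
  -- strictly larger open trace than v, so the search terminates.
  missingTrace : ISeparating C → ∃ (_∈ C) → ∃ λ v → ∀ w → N w ∩ C ≢ N[ v ] ∩ C
  missingTrace sep (v₀ , v₀∈C) = ascend v₀∈C (⊃-wellFounded _)
    where
    ascend : ∀ {v} → v ∈ C → Acc _⊃_ (N v ∩ C) → ∃ λ v → ∀ w → N w ∩ C ≢ N[ v ] ∩ C
    ascend {v} v∈C (acc larger) with any? (λ w → ≡-dec _≟ᵇ_ (N w ∩ C) (N[ v ] ∩ C))
    ... | no ∄w = v , λ w eq → ∄w (w , eq)
    ... | yes (w , eq) = ascend w∈C (larger (subst (N v ∩ C ⊂_) (sym eq) (Nv∩C⊂N[v]∩C v∈C)))
      where
      w∈C : w ∈ C
      w∈C = decidable-stable (w ∈? C) λ w∉C →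
        sep w v (λ { refl → w∉C v∈C }) (trans (N[v]∩C≡Nv∩C w∉C) eq)

  fSeparating∧totalDominating⇒< : .{{_ : NonZero n}} → FSeparating C → TotalDominating C → suc n < 2 ^ ∣ C ∣
  fSeparating∧totalDominating⇒< (osep , isep) dom = traceInjective⇒≤
    (◂-traceInjective {p = ⊥}
      (◂-traceInjective (separating⇒traceInjective osep) (proj₂ missing))
      -- The two extra subsets must also differ from each other: `N[ v ] ∩ C` is nonempty for the
      -- vertex `v` found by `missingTrace`.
      λ { zero    → nonempty⇒≢⊥∩ (totalDominating⇒dominating dom (proj₁ missing))
        ; (suc v) → nonempty⇒≢⊥∩ (dom v) })
    where
    vertex : ∀ {n} → .{{NonZero n}} → Fin n
    vertex {suc _} = zero
    -- The ascent starts from a neighbour in `C` of an arbitrary vertex, which exists by total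
    -- domination.
    missing = missingTrace isep (map₂ (proj₂ ∘ x∈p∩q⁻ (N vertex) C) (dom vertex))

  -- The minimum code defining `γ` is one instance. The empty graph has to be excluded: its only
  -- code has size `0`, whereas `lowerBound FD 0` is `1`.
  code⇒≥ : ∀ X .{{_ : NonZero n}} → IsCode G X C → ∣ C ∣ ≥ lowerBound X n
  -- Removing `suc` from both sides pays for the membership bit.
  code⇒≥ LD  (sep , _) = s≤s⁻¹ (n<2^k⇒⌊log₂n⌋<k n _ (lSeparating⇒< sep))
  code⇒≥ LTD (sep , _) = s≤s⁻¹ (n<2^k⇒⌊log₂n⌋<k n _ (lSeparating⇒< sep))
  code⇒≥ OD  (sep , _) = n≤2^k⇒⌈log₂n⌉≤k _ (oSeparating⇒≤ sep)
  code⇒≥ OTD (sep , dom) rewrite +-comm n 1 = n≤2^k⇒⌈log₂n⌉≤k _ (oSeparating∧totalDominating⇒< sep dom)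
  code⇒≥ ID  (sep , dom) rewrite +-comm n 1 = n≤2^k⇒⌈log₂n⌉≤k _ (iSeparating∧dominating⇒< sep dom)
  code⇒≥ ITD (sep , dom) rewrite +-comm n 1 =
    n≤2^k⇒⌈log₂n⌉≤k _ (iSeparating∧dominating⇒< sep (totalDominating⇒dominating dom))
  code⇒≥ FD  ((_ , sep) , dom) = n<2^k⇒⌊log₂n⌋<k n _ (iSeparating∧dominating⇒< sep dom)
  code⇒≥ FTD (sep , dom) rewrite +-comm n 1 =
    n<2^k⇒⌊log₂n⌋<k (suc n) _ (fSeparating∧totalDominating⇒< sep dom)

corollary3 : ∀ (X : CodeType) (n : ℕ) .{{_ : NonZero n}} (G : Graph n) (adm : Admissible G X) →
    γ G X adm ≥ lowerBound X n
corollary3 X n G adm = let C , code , _ = minimumCode G X adm in code⇒≥ G C X code
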